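{- Let $P$ be a unary and $R$ a binary relation symbol, and let $$\Sigma(P,R):=\forall x_1\Bigl[\bigl(P(x_1)\rightarrow\forall x_2(R(x_1,x_2)\leftrightarrow P(x_2))\bigr)\wedge\bigl(\neg P(x_1)\rightarrow\forall x_2\neg R(x_1,x_2)\bigr)\Bigr].$$ Over all structures, $R$ has no explicit fluted definition relative to the singleton theory $\{\Sigma(P,R)\}$; that is, there is no formula $\delta\in\mathsf{FL}[2](\{P\})$ such that for every $\{P\}$-structure $\mathfrak A$ and every $R^{\ast}\subseteq A^2$ with $(\mathfrak A,R^{\ast})\models\Sigma(P,R)$, and for all $(a_1,a_2)\in A^2$, $$R^{\ast}(a_1,a_2)\iff\mathfrak A\models\delta[a_1,a_2].$$
   Context: All structures have non-empty domains; there is no equality in the language. Fluted fragment. Fix variables $x_1,x_2,\ldots$. For a finite signature $\tau$ of relation symbols of positive arity, the levels $\mathsf{FL}[m](\tau)$, $m\ge 0$, are defined by simultaneous induction: $\top,\bot\in\mathsf{FL}[m](\tau)$; if $Q\in\tau$ has arity $r\le m$, then the suffix atom $Q(x_{m-r+1},\ldots,x_m)$ is in $\mathsf{FL}[m](\tau)$; $\mathsf{FL}[m](\tau)$ is closed under $\neg,\wedge,\vee$; if $\varphi\in\mathsf{FL}[m+1](\tau)$, then $\exists x_{m+1}\varphi,\forall x_{m+1}\varphi\in\mathsf{FL}[m](\tau)$. For $\varphi\in\mathsf{FL}[m](\tau)$ and $\bar a\in A^m$, $\mathfrak A\models\varphi[\bar a]$ means that $\varphi$ is true in $\mathfrak A$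 under the assignment $x_i\mapsto a_i$ ($1\le i\le m$). -}

module Defs where

open import Data.Empty using (⊥)
open import Data.Fin.Base using (Fin; zero; suc)
open import Data.Nat.Base using (ℕ; zero; suc; _≤_; _<_; _∸_; z≤n; s≤s)
open import Data.Nat.Properties using (m∸n+n≡m)
open import Data.Product.Base using (_×_; ∃-syntax)
open import Data.Sum.Base using (_⊎_)
open import Data.Unit.Base using (⊤)
open import Data.Vec.Base using (Vec; []; _∷_; _∷ʳ_; cast; drop)
open import Level using (0ℓ)
open import Relation.Binary.Core using (Rel)
open import Relation.Binary.PropositionalEquality.Core using (sym)
open import Relation.Nullary.Negation.Core using (¬_)

record Signature : Set where
  field
    size           : ℕ
    arity          : Fin size → ℕ
    arity-positive : ∀ Q → 0 < arity Q

  Symbol : Set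
  Symbol = Fin size

record Structure (τ : Signature) : Set₁ where
  open Signature τ
  field
    Carrier  : Set
    nonempty : Carrier
    rel      : (Q : Symbol) → Vec Carrier (arity Q) → Set

-- FL τ m is the level FL[m](τ).  Variables need not be written: an atom at
-- level m with symbol Q of arity r always has arguments x_{m-r+1}, …, x_m, and
-- a quantifier leading from level m + 1 to level m always binds x_{m+1}.

infix  8 `¬_
infixr 7 _`∧_
infixr 6 _`∨_
infixr 5 _`→_ _`↔_

data FL (τ : Signature) : ℕ → Set where
  `⊤ `⊥     : ∀ {m} → FL τ m
  atom      : ∀ {m} (Q : Signature.Symbol τ) → Signature.arity τ Q ≤ m → FL τ m
  `¬_       : ∀ {m} → FL τ m → FL τ m
  _`∧_ _`∨_ : ∀ {m} → FL τ m → FL τ m → FL τ m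
  `∃ `∀     : ∀ {m} → FL τ (suc m) → FL τ m

_`→_ _`↔_ : ∀ {τ m} → FL τ m → FL τ m → FL τ m
φ `→ ψ = `¬ φ `∨ ψ
φ `↔ ψ = (φ `→ ψ) `∧ (ψ `→ φ)

-- (a_1, …, a_m) ↦ (a_{m-r+1}, …, a_m)
suffix : ∀ {A : Set} {r m} → r ≤ m → Vec A m → Vec A r
suffix {r = r} {m} r≤m as = drop (m ∸ r) (cast (sym (m∸n+n≡m r≤m)) as)

infix 4 _⊨_[_]

-- The vector [a_1, …, a_m] is the assignment x_i ↦ a_i, so the value of
-- x_{m+1} is appended at the end.
_⊨_[_] : ∀ {τ m} (𝔄 : Structure τ) → FL τ m → Vec (Structure.Carrier 𝔄) m → Set
𝔄 ⊨ `⊤ [ as ]         = ⊤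
𝔄 ⊨ `⊥ [ as ]         = ⊥
𝔄 ⊨ atom Q r≤m [ as ] = Structure.rel 𝔄 Q (suffix r≤m as)
𝔄 ⊨ `¬ φ [ as ]       = ¬ (𝔄 ⊨ φ [ as ])
𝔄 ⊨ φ `∧ ψ [ as ]     = (𝔄 ⊨ φ [ as ]) × (𝔄 ⊨ ψ [ as ])
𝔄 ⊨ φ `∨ ψ [ as ]     = (𝔄 ⊨ φ [ as ]) ⊎ (𝔄 ⊨ ψ [ as ])
𝔄 ⊨ `∃ φ [ as ]       = ∃[ a ] (𝔄 ⊨ φ [ as ∷ʳ a ])
𝔄 ⊨ `∀ φ [ as ]       = ∀ a → 𝔄 ⊨ φ [ as ∷ʳ a ]

⟨P⟩ : Signature
⟨P⟩ = record
  { size           = 1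
  ; arity          = λ { zero → 1 }
  ; arity-positive = λ { zero → s≤s z≤n }
  }

⟨P,R⟩ : Signature
⟨P,R⟩ = record
  { size           = 2
  ; arity          = λ { zero → 1 ; (suc zero) → 2 }
  ; arity-positive = λ { zero → s≤s z≤n ; (suc zero) → s≤s z≤n }
  }

expand : (𝔄 : Structure ⟨P⟩) → Rel (Structure.Carrier 𝔄) 0ℓ → Structure ⟨P,R⟩
expand 𝔄 R* = record
  { Carrier  = Carrier
  ; nonempty = nonempty
  ; rel      = λ { zero as → rel zero as ; (suc zero) (a ∷ b ∷ []) → R* a b }
  }
  where open Structure 𝔄

Σ⟨P,R⟩ : FL ⟨P,R⟩ 0
Σ⟨P,R⟩ = `∀ ((P[x₁] `→ `∀ (R[x₁,x₂] `↔ P[x₂])) `∧ (`¬ P[x₁] `→ `∀ (`¬ R[x₁,x₂])))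
  where
  P[x₁] : FL ⟨P,R⟩ 1
  P[x₁] = atom zero (s≤s z≤n)

  P[x₂] R[x₁,x₂] : FL ⟨P,R⟩ 2
  P[x₂]    = atom zero (s≤s z≤n)
  R[x₁,x₂] = atom (suc zero) (s≤s (s≤s z≤n))

-- A unary atom at a positive level constrains only the last variable, and a
-- quantifier puts a fresh variable last, so at positive levels a fluted formula
-- over ⟨P⟩ sees only the last value of the assignment.  On Bool with P = {true},
-- Σ⟨P,R⟩ forces R = P × P, which separates (true , true) from (false , true).
module Submission where

open import Defs
open import Data.Bool.Base using (Bool; true; false; T; _∧_)
open import Data.Fin.Base using (zero)
open import Data.Nat.Base using (suc; _+_)
open import Data.Product.Base as Product using (Σ-syntax; _,_)
open import Data.Sum.Base as Sum using (inj₁; inj₂)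
open import Data.Unit.Base using (tt)
open import Data.Vec.Base using (Vec; []; _∷_; _∷ʳ_; cast; drop; head)
open import Function.Base using (_∘_)
open import Function.Bundles using (_⇔_; Equivalence)
open import Level using (0ℓ)
open import Relation.Binary.Core using (Rel)
open import Relation.Binary.PropositionalEquality using (_≡_; refl; sym; trans; subst)
open import Relation.Nullary.Negation.Core using (¬_)

-- The left side is what `suffix` unfolds to for a unary atom at level `suc m`.
drop-∷ʳ : ∀ {A : Set} {m} .(eq : suc m ≡ m + 1) (as : Vec A m) (a : A) →
          drop m (cast eq (as ∷ʳ a)) ≡ a ∷ []
drop-∷ʳ eq []       a = refl
drop-∷ʳ eq (_ ∷ as) a = drop-∷ʳ _ as a

module _ (𝔄 : Structure ⟨P⟩) where
  open Structure 𝔄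

  ⊨-last : ∀ {m} (φ : FL ⟨P⟩ (suc m)) (as bs : Vec Carrier m) (a : Carrier) →
           𝔄 ⊨ φ [ as ∷ʳ a ] → 𝔄 ⊨ φ [ bs ∷ʳ a ]
  ⊨-last `⊤            as bs a = λ t → t
  ⊨-last `⊥            as bs a = λ f → f
  ⊨-last (atom zero _) as bs a =
    subst (rel zero) (trans (drop-∷ʳ _ as a) (sym (drop-∷ʳ _ bs a)))
  -- Negation is contravariant, so the two prefixes swap.
  ⊨-last (`¬ φ)        as bs a = _∘ ⊨-last φ bs as a
  ⊨-last (φ `∧ ψ)      as bs a = Product.map (⊨-last φ as bs a) (⊨-last ψ as bs a)
  ⊨-last (φ `∨ ψ)      as bs a = Sum.map (⊨-last φ as bs a) (⊨-last ψ as bs a)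
  -- The old last value `a` joins both prefixes; the quantified value takes its place.
  ⊨-last (`∃ φ)        as bs a = Product.map₂ (⊨-last φ (as ∷ʳ a) (bs ∷ʳ a) _)
  ⊨-last (`∀ φ)        as bs a = λ h c → ⊨-last φ (as ∷ʳ a) (bs ∷ʳ a) c (h c)

𝔹 : Structure ⟨P⟩
𝔹 = record
  { Carrier  = Bool
  ; nonempty = true
  ; rel      = λ { zero as → T (head as) }
  }

P×P : Rel Bool 0ℓ
P×P a b = T (a ∧ b)

𝔹⊨Σ : expand 𝔹 P×P ⊨ Σ⟨P,R⟩ [ [] ]
-- Implications abbreviate disjunctions, so a disjunct is chosen for each Boolean value.
𝔹⊨Σ true  = inj₂ (λ { true  → inj₂ tt , inj₂ tt
                    ; false → inj₁ (λ ()) , inj₁ (λ ()) })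
          , inj₁ (λ ¬p → ¬p tt)
𝔹⊨Σ false = inj₁ (λ ()) , inj₂ (λ _ ())

theorem5p5 : ¬ (Σ[ δ ∈ FL ⟨P⟩ 2 ] ((𝔄 : Structure ⟨P⟩) (R* : Rel (Structure.Carrier 𝔄) 0ℓ) →
    expand 𝔄 R* ⊨ Σ⟨P,R⟩ [ [] ] →
    (a₁ a₂ : Structure.Carrier 𝔄) →
    R* a₁ a₂ ⇔ (𝔄 ⊨ δ [ a₁ ∷ a₂ ∷ [] ])))
theorem5p5 (δ , defines) =
  -- `P×P false true` reduces to the empty type, so its proof is the contradiction.
  from (R⇔δ false true) (⊨-last 𝔹 δ (true ∷ []) (false ∷ []) true (to (R⇔δ true true) tt))
  where
  open Equivalence
  R⇔δ = defines 𝔹 P×P 𝔹⊨Σ
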